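{- Let $T=\{2143,2341,2413\}$. Then $$F_T(x)=\frac{1-4x+3x^2-x^3}{1-5x+6x^2-3x^3}.$$
   Context: $S_n(T)$ denotes the set of permutations $\pi$ of $[n]=\{1,\dots,n\}$ (one-line notation) that avoid every pattern $\tau\in T$, i.e. no subsequence of $\pi$ is order-isomorphic to $\tau$. $F_T(x)=\sum_{n\ge 0}|S_n(T)|x^n$, a formal power series, with $|S_0(T)|=1$. -}

module Defs where

open import Data.Fin.Base as Fin using (Fin; toℕ)
import Data.Fin.Properties as Fin
open import Data.Integer.Base as ℤ using (ℤ; +_)
import Data.Integer.Properties as ℤ
open import Data.Integer.Tactic.RingSolver using (solve-∀)
open import Data.List.Base as List
  using (List; []; _∷_; allFin; cartesianProductWith; filter; length)
open import Data.List.Membership.Propositional using (_∈_; find; lose)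
open import Data.List.Membership.Propositional.Properties
  using (∈-allFin; ∈-cartesianProductWith⁺; ∈-filter⁺; ∈-filter⁻)
open import Data.List.Relation.Unary.All as All using (All)
open import Data.List.Relation.Unary.Any as Any using (here)
open import Data.List.Relation.Unary.AllPairs using ([]; _∷_)
open import Data.List.Relation.Unary.Unique.Propositional using (Unique)
import Data.List.Relation.Unary.Unique.Propositional.Properties as Unique
open import Data.Nat.Base using (ℕ; zero; suc; _<_; _∸_)
open import Data.Nat.Properties using (_<?_)
open import Data.Product.Base using (∃; _×_; _,_; proj₁; proj₂)
open import Data.Vec.Base using (Vec; []; _∷_; lookup)
open import Data.Vec.Properties using (∷-injective)
open import Data.Vec.Relation.Unary.AllPairs as AllPairs using (AllPairs)
open import Function.Base using (_∘_)
open import Function.Bundles using (_⇔_; mk⇔; Equivalence)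
open import Function.Consequences.Propositional
  using (strictlySurjective⇒surjective; surjective⇒strictlySurjective)
open import Function.Definitions using (Bijective)
open import Relation.Binary.PropositionalEquality
open import Relation.Nullary.Decidable
  using (Dec; map′; True; toWitness; ¬?; _×-dec_; _→-dec_)
open import Relation.Nullary.Negation using (¬_)

open import Algebra.Properties.Semiring.Sum ℤ.+-*-semiring
  using (sum-syntax)

------------------------------------------------------------------------
-- Permutations and pattern avoidance

-- A word of length k over [n].  The letters 1, …, n are represented by
-- the elements 0, …, n - 1 of Fin n; only their relative order matters.

Word : ℕ → ℕ → Set
Word n k = Vec (Fin n) k

IsPermutation : ∀ {n} → Word n n → Set
IsPermutation π = Bijective _≡_ _≡_ (lookup π)

-- A pattern in one-line notation, e.g. 2143 is 2 ∷ 1 ∷ 4 ∷ 3 ∷ [].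

Pattern : Set
Pattern = List ℕ

-- The subsequence of π at the positions p is order-isomorphic to τ.

OccursAt : ∀ {n} → (τ : Pattern) → Word n n → Word n (length τ) → Set
OccursAt τ π p =
  AllPairs Fin._<_ p ×
  (∀ i j → (lookup π (lookup p i) Fin.< lookup π (lookup p j)) ⇔
           (List.lookup τ i < List.lookup τ j))

Contains : ∀ {n} → Word n n → Pattern → Set
Contains π τ = ∃ λ p → OccursAt τ π p

Avoids : ∀ {n} → List Pattern → Word n n → Set
Avoids T π = All (λ τ → ¬ Contains π τ) T

words : ∀ n k → List (Word n k)
words n zero    = [] ∷ []
words n (suc k) = cartesianProductWith _∷_ (allFin n) (words n k)

∈-words : ∀ {n k} (w : Word n k) → w ∈ words n k
∈-words []      = here refl
∈-words (x ∷ w) = ∈-cartesianProductWith⁺ _∷_ (∈-allFin x) (∈-words w)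

words-unique : ∀ n k → Unique (words n k)
words-unique n zero    = All.[] ∷ []
words-unique n (suc k) =
  Unique.cartesianProductWith⁺ _∷_ ∷-injective
    (Unique.allFin⁺ n) (words-unique n k)

isPermutation? : ∀ {n} (π : Word n n) → Dec (IsPermutation π)
isPermutation? π = injective? ×-dec surjective?
  where
  injective? = map′ (λ inj {i} {j} → inj i j) (λ inj i j → inj {i} {j})
    (Fin.all? λ i → Fin.all? λ j →
      (lookup π i Fin.≟ lookup π j) →-dec (i Fin.≟ j))
  surjective? = map′ strictlySurjective⇒surjective surjective⇒strictlySurjective
    (Fin.all? λ y → Fin.any? λ i → lookup π i Fin.≟ y)

occursAt? : ∀ {n} τ (π : Word n n) p → Dec (OccursAt τ π p)
occursAt? τ π p =
  AllPairs.allPairs? Fin._<?_ p ×-dec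
  (Fin.all? λ i → Fin.all? λ j →
    ⇔-dec (lookup π (lookup p i) Fin.<? lookup π (lookup p j))
          (List.lookup τ i <? List.lookup τ j))
  where
  ⇔-dec : ∀ {A B : Set} → Dec A → Dec B → Dec (A ⇔ B)
  ⇔-dec a? b? = map′ (λ (f , g) → mk⇔ f g)
    (λ e → Equivalence.to e , Equivalence.from e)
    ((a? →-dec b?) ×-dec (b? →-dec a?))

contains? : ∀ {n} (π : Word n n) τ → Dec (Contains π τ)
contains? {n} π τ = map′
  (λ any → let (p , _ , o) = find any in p , o)
  (λ (p , o) → lose (∈-words p) o)
  (Any.any? (occursAt? τ π) (words n (length τ)))

avoids? : ∀ {n} T (π : Word n n) → Dec (Avoids T π)
avoids? T π = All.all? (λ τ → ¬? (contains? π τ)) T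

-- S T n lists the elements of Sₙ(T), each exactly once.

S : List Pattern → ∀ n → List (Word n n)
S T n = filter (λ π → isPermutation? π ×-dec avoids? T π) (words n n)

∈-S : ∀ T n (π : Word n n) → π ∈ S T n ⇔ (IsPermutation π × Avoids T π)
∈-S T n π = mk⇔
  (proj₂ ∘ ∈-filter⁻ (λ π → isPermutation? π ×-dec avoids? T π) {xs = words n n})
  (∈-filter⁺ (λ π → isPermutation? π ×-dec avoids? T π) (∈-words π))

S-unique : ∀ T n → Unique (S T n)
S-unique T n =
  Unique.filter⁺ (λ π → isPermutation? π ×-dec avoids? T π) (words-unique n n)

------------------------------------------------------------------------
-- Formal power series over ℤ, as coefficient sequences

Series : Set
Series = ℕ → ℤ

infix  4 _≈_
infixl 7 _*_ _/_

_≈_ : Series → Series → Set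
f ≈ g = ∀ n → f n ≡ g n

_*_ : Series → Series → Series
(f * g) n = ∑[ i < suc n ] (f (toℕ i) ℤ.* g (n ∸ toℕ i))

-- Coefficients by increasing degree.

polynomial : List ℤ → Series
polynomial []       _       = + 0
polynomial (c ∷ cs) zero    = c
polynomial (c ∷ cs) (suc n) = polynomial cs n

-- Long division: if f = q g and g 0 = 1 then q 0 = f 0 and
-- (f - f 0 · g) / x = ((q - q 0) / x) g.

quotient : Series → Series → Series
quotient f g zero    = f 0
quotient f g (suc n) = quotient (λ k → f (suc k) ℤ.- f 0 ℤ.* g (suc k)) g n

_/_ : (f g : Series) {_ : True (g 0 ℤ.≟ + 1)} → Series
f / g = quotient f g

-- f / g is the unique series whose product with g is f.

/-* : ∀ f g {u : True (g 0 ℤ.≟ + 1)} → (_/_ f g {u}) * g ≈ f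
/-* f g {u} zero = begin
  f 0 ℤ.* g 0 ℤ.+ + 0  ≡⟨ cong (λ c → f 0 ℤ.* c ℤ.+ + 0) (toWitness u) ⟩
  f 0 ℤ.* + 1 ℤ.+ + 0  ≡⟨ unit (f 0) ⟩
  f 0                  ∎
  where
  open ≡-Reasoning
  unit : ∀ a → a ℤ.* + 1 ℤ.+ + 0 ≡ a
  unit = solve-∀
/-* f g {u} (suc n) = begin
  f 0 ℤ.* g (suc n) ℤ.+ (_/_ f′ g {u} * g) n
    ≡⟨ cong (ℤ._+_ (f 0 ℤ.* g (suc n))) (/-* f′ g {u} n) ⟩
  f 0 ℤ.* g (suc n) ℤ.+ (f (suc n) ℤ.- f 0 ℤ.* g (suc n))
    ≡⟨ cancel (f 0 ℤ.* g (suc n)) (f (suc n)) ⟩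
  f (suc n)  ∎
  where
  open ≡-Reasoning
  f′ : Series
  f′ k = f (suc k) ℤ.- f 0 ℤ.* g (suc k)
  cancel : ∀ a b → a ℤ.+ (b ℤ.- a) ≡ b
  cancel = solve-∀

/-unique : ∀ q f g {u : True (g 0 ℤ.≟ + 1)} → q * g ≈ f → q ≈ _/_ f g {u}
/-unique q f g {u} q*g≈f = go
  where
  open ≡-Reasoning
  unit : ∀ a → a ≡ a ℤ.* + 1 ℤ.+ + 0
  unit = solve-∀
  cancel : ∀ a b → b ≡ (a ℤ.+ b) ℤ.- a
  cancel = solve-∀
  f′ : Series
  f′ k = f (suc k) ℤ.- f 0 ℤ.* g (suc k)
  head : q 0 ≡ f 0
  head = begin
    q 0                  ≡⟨ unit (q 0) ⟩
    q 0 ℤ.* + 1 ℤ.+ + 0  ≡⟨ cong (λ c → q 0 ℤ.* c ℤ.+ + 0) (toWitness u) ⟨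
    (q * g) 0            ≡⟨ q*g≈f 0 ⟩
    f 0                  ∎
  tail : (q ∘ suc) * g ≈ f′
  tail n = begin
    ((q ∘ suc) * g) n                       ≡⟨ cancel (q 0 ℤ.* g (suc n)) _ ⟩
    (q * g) (suc n) ℤ.- q 0 ℤ.* g (suc n)   ≡⟨ cong₂ (λ a b → a ℤ.- b ℤ.* g (suc n)) (q*g≈f (suc n)) head ⟩
    f′ n                                    ∎
  go : q ≈ _/_ f g {u}
  go zero    = head
  go (suc n) = /-unique (q ∘ suc) f′ g {u} tail n

F : List Pattern → Series
F T n = + length (S T n)

{-# OPTIONS --safe #-}
module Submission where

-- Let aₙ be the number of avoiders of length n and mₙ the number of those
-- whose maximum is neither first nor last.  A first letter can only play the
-- 2 of a pattern and a last letter only a 1 or a 3, so putting a new maximum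
-- first or last never creates a pattern; hence aₙ₊₁ = 2 aₙ + mₙ₊₁ for n ≥ 1.
-- An avoider of length n + 1 with interior maximum and first letter v has
-- one of three forms:
--   * v is the minimum; then the rest is any avoider whose maximum is not
--     last (aₙ₋₁ + mₙ of them);
--   * v is not the minimum and the maximum is second; then the letters above
--     v follow v in decreasing order, and after them comes any avoider of the
--     letters below v (dₙ₊₁ of them, with dₙ₊₁ = dₙ + aₙ₋₁);
--   * otherwise v must be the second largest letter, and the rest is any
--     avoider with interior maximum (mₙ of them).
-- So mₙ₊₁ = aₙ₋₁ + 2 mₙ + dₙ₊₁, and eliminating m and d gives
-- aₙ₊₃ = 5 aₙ₊₂ - 6 aₙ₊₁ + 3 aₙ for n ≥ 1.

open import Defs
open import Data.Empty using (⊥; ⊥-elim)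
open import Data.Fin.Base as Fin using (Fin; zero; suc; toℕ; fromℕ<)
open import Data.Fin.Patterns using (0F; 1F; 2F; 3F)
import Data.Fin.Properties as Fin
open import Data.Integer.Base as ℤ using (+_; -_)
import Data.Integer.Properties as ℤ
import Data.Integer.Tactic.RingSolver as ℤSolver
open import Data.List.Base as List
  using (List; []; _∷_; _++_; _∷ʳ_; map; length; downFrom)
import Data.List.Properties as List
open import Data.List.Membership.Propositional using (_∈_; _∉_)
open import Data.List.Membership.Propositional.Properties
  using (∈-∃++; ∈-++⁺ˡ; ∈-++⁺ʳ; ∈-++⁻; ∈-map⁺; ∈-map⁻; ∈-downFrom⁺; ∈-downFrom⁻)
open import Data.List.Membership.Propositional.Properties.WithK using (unique∧set⇒bag)
open import Data.List.Relation.Binary.BagAndSetEquality using (∼bag⇒↭)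
open import Data.List.Relation.Binary.Disjoint.Propositional using (Disjoint)
open import Data.List.Relation.Binary.Permutation.Propositional
  using (_↭_; ↭-refl; ↭-reflexive; ↭-sym; ↭-trans; ↭-prep; ↭-swap; ↭⇒↭ₛ)
open import Data.List.Relation.Binary.Permutation.Propositional.Properties
  using (∈-resp-↭; ↭-length; ↭-map-inv; ↭-singleton-inv; shift; drop-∷)
  renaming (map⁺ to ↭-map⁺)
open import Data.List.Relation.Binary.Permutation.Setoid.Properties using (Unique-resp-↭)
open import Data.List.Relation.Binary.Sublist.Propositional
  using (_⊆_; []; _∷_; minimum; from∈; ⊆-refl; ⊆-trans; lookup)
  renaming (_∷ʳ_ to _∷ˢ_)
open import Data.List.Relation.Binary.Sublist.Propositional.Properties
  using (++⁺; ++⁺ˡ) renaming (map⁺ to ⊆-map⁺)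
open import Data.List.Relation.Unary.All as All using (All; []; _∷_)
import Data.List.Relation.Unary.All.Properties as All
open import Data.List.Relation.Unary.AllPairs using ([]; _∷_)
open import Data.List.Relation.Unary.Any using (here; there)
open import Data.List.Relation.Unary.Unique.Propositional using (Unique)
import Data.List.Relation.Unary.Unique.Propositional.Properties as Unique
open import Data.Nat.Base as ℕ hiding (_*_; _/_)
open import Data.Nat.Properties
import Data.Nat.Tactic.RingSolver as ℕSolver
open import Data.Product.Base using (∃; ∃₂; _×_; _,_; proj₁; proj₂)
open import Data.Product.Properties using (,-injectiveʳ)
open import Data.Sum.Base using (_⊎_; inj₁; inj₂)
open import Data.Vec.Base as Vec using (Vec; []; _∷_; toList)
import Data.Vec.Membership.Propositional.Properties as Vec
import Data.Vec.Properties as Vec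
import Data.Vec.Relation.Unary.All as VecAll
import Data.Vec.Relation.Unary.All.Properties as VecAll
import Data.Vec.Relation.Unary.AllPairs as VecAllPairs
import Data.Vec.Relation.Unary.AllPairs.Properties as VecAllPairs
import Data.Vec.Relation.Unary.Any as VecAny
import Data.Vec.Relation.Unary.Any.Properties as VecAny
open import Function.Base using (_∘_; id)
open import Function.Bundles using (mk⇔; Equivalence)
open import Function.Consequences.Propositional
  using (strictlySurjective⇒surjective; surjective⇒strictlySurjective)
open import Function.Definitions using (Injective; StrictlySurjective)
open import Relation.Binary.Definitions using (tri<; tri≈; tri>)
open import Relation.Binary.PropositionalEquality
open import Relation.Nullary.Decidable using (yes; no)
open import Relation.Nullary.Negation using (¬_; contradiction)

private
  variable
    A B : Set
    k m n v w x y z : ℕ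
    σ τ υ : List ℕ

-- Sublists and splittings of lists.

⊆-map⁻ : (f : A → B) {xs : List B} (ys : List A) → xs ⊆ map f ys →
         ∃ λ xs′ → xs ≡ map f xs′ × xs′ ⊆ ys
⊆-map⁻ f []       []          = [] , refl , []
⊆-map⁻ f (y ∷ ys) (_ ∷ˢ s)    with xs′ , eq , s′ ← ⊆-map⁻ f ys s = xs′ , eq , y ∷ˢ s′
⊆-map⁻ f (y ∷ ys) (refl ∷ s)  with xs′ , eq , s′ ← ⊆-map⁻ f ys s =
  y ∷ xs′ , cong (f y ∷_) eq , refl ∷ s′

⊆-∷ʳ⁻ : {a : A} {xs : List A} (ys : List A) → xs ⊆ ys ∷ʳ a →
        xs ⊆ ys ⊎ ∃ λ xs′ → xs ≡ xs′ ∷ʳ a × xs′ ⊆ ys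
⊆-∷ʳ⁻ []       (_ ∷ˢ s)    = inj₁ s
⊆-∷ʳ⁻ []       (refl ∷ []) = inj₂ ([] , refl , [])
⊆-∷ʳ⁻ (y ∷ ys) (_ ∷ˢ s) with ⊆-∷ʳ⁻ ys s
... | inj₁ s′             = inj₁ (y ∷ˢ s′)
... | inj₂ (_ , eq , s′)  = inj₂ (_ , eq , y ∷ˢ s′)
⊆-∷ʳ⁻ (y ∷ ys) (refl ∷ s) with ⊆-∷ʳ⁻ ys s
... | inj₁ s′             = inj₁ (refl ∷ s′)
... | inj₂ (_ , eq , s′)  = inj₂ (y ∷ _ , cong (y ∷_) eq , refl ∷ s′)

∈-pair⊆ : {x y : A} {l : List A} → x ∈ l → y ∈ l → x ≢ y →
          x ∷ y ∷ [] ⊆ l ⊎ y ∷ x ∷ [] ⊆ l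
∈-pair⊆ (here refl) (here refl) x≢y = contradiction refl x≢y
∈-pair⊆ (here refl) (there q)   _   = inj₁ (refl ∷ from∈ q)
∈-pair⊆ (there p)   (here refl) _   = inj₂ (refl ∷ from∈ p)
∈-pair⊆ (there p)   (there q)   x≢y with ∈-pair⊆ p q x≢y
... | inj₁ s = inj₁ (_ ∷ˢ s)
... | inj₂ s = inj₂ (_ ∷ˢ s)

-- Compares two splittings of a permutation around its maximum: on both sides the marked `a` is the
-- first occurrence.
++-∷-unique : {a : A} {xs xs′ ys ys′ : List A} → a ∉ xs → a ∉ xs′ →
              xs ++ a ∷ ys ≡ xs′ ++ a ∷ ys′ → xs ≡ xs′ × ys ≡ ys′
++-∷-unique {xs = []}    {[]}      p q refl = refl , refl
++-∷-unique {xs = []}    {_ ∷ _}   p q eq   = contradiction (here (List.∷-injectiveˡ eq)) q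
++-∷-unique {xs = _ ∷ _} {[]}      p q eq   = contradiction (here (sym (List.∷-injectiveˡ eq))) p
++-∷-unique {xs = x ∷ _} {_ ∷ _}   p q eq
  with refl ← List.∷-injectiveˡ eq
  with refl , refl ← ++-∷-unique (p ∘ there) (q ∘ there) (List.∷-injectiveʳ eq) = refl , refl

map-++-∷⁻ : (f : A → B) {b : B} (l : List A) (xs : List B) {ys : List B} →
            map f l ≡ xs ++ b ∷ ys →
            ∃ λ xs′ → ∃₂ λ a ys′ → l ≡ xs′ ++ a ∷ ys′ × xs ≡ map f xs′ × b ≡ f a × ys ≡ map f ys′
map-++-∷⁻ f (_ ∷ _) []       refl = [] , _ , _ , refl , refl , refl , refl
map-++-∷⁻ f (a ∷ l) (x ∷ xs) eq
  with refl ← List.∷-injectiveˡ eq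
  with xs′ , _ , _ , refl , refl , refl , refl ← map-++-∷⁻ f l xs (List.∷-injectiveʳ eq) =
  a ∷ xs′ , _ , _ , refl , refl , refl , refl

-- Relabelling around a missing letter.

-- The increasing enumeration of the numbers other than `v`; applied to every letter of a word, it
-- makes room for a new letter `v`.
skip : ℕ → ℕ → ℕ
skip zero    x       = suc x
skip (suc v) zero    = zero
skip (suc v) (suc x) = suc (skip v x)

skip-mono-< : ∀ v → x < y → skip v x < skip v y
skip-mono-<                 zero    x<y       = s<s x<y
skip-mono-< {zero}  {suc y} (suc v) _         = z<s
skip-mono-< {suc x} {suc y} (suc v) (s<s x<y) = s<s (skip-mono-< v x<y)

skip-cancel-< : ∀ v → skip v x < skip v y → x < y
skip-cancel-< {x} {y} v lt with <-cmp x y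
... | tri< x<y _ _  = x<y
... | tri≈ _ refl _ = contradiction lt (<-irrefl refl)
... | tri> _ _ y<x  = contradiction lt (<-asym (skip-mono-< v y<x))

skip-injective : ∀ v → skip v x ≡ skip v y → x ≡ y
skip-injective                 zero    eq = suc-injective eq
skip-injective {zero}  {zero}  (suc v) eq = refl
skip-injective {suc x} {suc y} (suc v) eq = cong suc (skip-injective v (suc-injective eq))

x<v⇒skip≡x : x < v → skip v x ≡ x
x<v⇒skip≡x {zero}  {suc v} _         = refl
x<v⇒skip≡x {suc x} {suc v} (s<s x<v) = cong suc (x<v⇒skip≡x x<v)

v≤x⇒skip≡1+x : v ≤ x → skip v x ≡ suc x
v≤x⇒skip≡1+x {zero}          _         = refl
v≤x⇒skip≡1+x {suc v} {suc x} (s≤s v≤x) = cong suc (v≤x⇒skip≡1+x v≤x)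

-- Permutations as lists.

-- `downFrom (suc n)` begins with `n`, which reduces inserting or deleting a maximum to `shift` and
-- one cons step.
Perm : ℕ → List ℕ → Set
Perm n l = downFrom n ↭ l

perm⇒< : Perm n σ → x ∈ σ → x < n
perm⇒< p x∈σ = ∈-downFrom⁻ (∈-resp-↭ (↭-sym p) x∈σ)

perm⇒∈ : Perm n σ → x < n → x ∈ σ
perm⇒∈ p x<n = ∈-resp-↭ p (∈-downFrom⁺ x<n)

perm⇒unique : Perm n σ → Unique σ
perm⇒unique p = Unique-resp-↭ (setoid ℕ) (↭⇒↭ₛ p) (Unique.downFrom⁺ _)

-- Unless `v` is the top letter, `skip v` sends the largest old letter to the largest new one, which
-- moves past `v` by a swap. If `v` is the top letter, `skip v` fixes everything below it.
downFrom-skip : v ≤ n → Perm (suc n) (v ∷ map (skip v) (downFrom n))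
downFrom-skip {n = zero}  z≤n = ↭-refl
downFrom-skip {v} {suc n} v≤1+n with m≤n⇒m<n∨m≡n v≤1+n
... | inj₁ (s<s v≤n) rewrite v≤x⇒skip≡1+x v≤n =
  ↭-trans (↭-prep _ (downFrom-skip v≤n)) (↭-swap _ _ ↭-refl)
... | inj₂ refl =
  ↭-prep v (↭-reflexive (sym (List.map-id-local (All.tabulate (x<v⇒skip≡x ∘ ∈-downFrom⁻)))))

-- σ is the standardisation of the tail of v ◂ σ.

infixr 5 _◂_

_◂_ : ℕ → List ℕ → List ℕ
v ◂ σ = v ∷ map (skip v) σ

perm-◂⁺ : v ≤ n → Perm n σ → Perm (suc n) (v ◂ σ)
perm-◂⁺ v≤n p = ↭-trans (downFrom-skip v≤n) (↭-prep _ (↭-map⁺ _ p))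

perm-◂⁻ : Perm (suc n) (v ∷ τ) → ∃ λ σ → τ ≡ map (skip v) σ × Perm n σ
perm-◂⁻ p = ↭-map-inv (skip _)
  (drop-∷ (↭-trans (↭-sym (downFrom-skip (≤-pred (perm⇒< p (here refl))))) p))

perm-insert⁺ : ∀ σ → Perm n (σ ++ τ) → Perm (suc n) (σ ++ n ∷ τ)
perm-insert⁺ σ p = ↭-trans (↭-prep _ p) (↭-sym (shift _ σ _))

perm-insert⁻ : ∀ σ → Perm (suc n) (σ ++ n ∷ τ) → Perm n (σ ++ τ)
perm-insert⁻ σ p = drop-∷ (↭-trans p (shift _ σ _))

perm-insert-∉ˡ : ∀ σ → Perm (suc n) (σ ++ n ∷ τ) → n ∉ σ
perm-insert-∉ˡ σ p n∈σ = <-irrefl refl (perm⇒< (perm-insert⁻ σ p) (∈-++⁺ˡ n∈σ))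

-- Pattern avoidance for lists.

-- The arguments come in order of position, the inequalities in order of value; each chain fixes the
-- whole order type.
data Forbidden (w x y z : ℕ) : Set where
  f2143 : x < w → w < z → z < y → Forbidden w x y z
  f2341 : z < w → w < x → x < y → Forbidden w x y z
  f2413 : y < w → w < z → z < x → Forbidden w x y z

Avoiding : List ℕ → Set
Avoiding l = ∀ {w x y z} → w ∷ x ∷ y ∷ z ∷ [] ⊆ l → ¬ Forbidden w x y z

avoiding-⊆ : σ ⊆ τ → Avoiding τ → Avoiding σ
avoiding-⊆ s av = av ∘ λ t → ⊆-trans t s

-- Taking `f` or `g` to be `id` gives the two directions along `skip`: producing a pattern among the
-- images and reflecting one.
forbidden-map : ∀ {f g : ℕ → ℕ} → (∀ {x y} → f x < f y → g x < g y) →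
                Forbidden (f w) (f x) (f y) (f z) → Forbidden (g w) (g x) (g y) (g z)
forbidden-map h (f2143 a b c) = f2143 (h a) (h b) (h c)
forbidden-map h (f2341 a b c) = f2341 (h a) (h b) (h c)
forbidden-map h (f2413 a b c) = f2413 (h a) (h b) (h c)

avoiding-skip⁺ : ∀ v → Avoiding σ → Avoiding (map (skip v) σ)
avoiding-skip⁺ {σ} v av s f with ⊆-map⁻ (skip v) σ s
... | _ ∷ _ ∷ _ ∷ _ ∷ [] , refl , s′ = av s′ (forbidden-map {g = id} (skip-cancel-< v) f)

avoiding-skip⁻ : ∀ v → Avoiding (map (skip v) σ) → Avoiding σ
avoiding-skip⁻ v av s f = av (⊆-map⁺ (skip v) s) (forbidden-map {f = id} (skip-mono-< v) f)

-- In each pattern some later letter is smaller than the first.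
avoiding-0∷ : Avoiding σ → Avoiding (0 ∷ σ)
avoiding-0∷ av (_ ∷ˢ s)   f              = av s f
avoiding-0∷ av (refl ∷ s) (f2143 () _ _)
avoiding-0∷ av (refl ∷ s) (f2341 () _ _)
avoiding-0∷ av (refl ∷ s) (f2413 () _ _)

-- In each pattern the first letter is followed by two larger ones.

avoiding-large∷ : Avoiding σ → (∀ {x} → x ∈ σ → x < 2 + v) → Avoiding (v ∷ σ)
avoiding-large∷ {σ} {v} av bound = λ where
    (_ ∷ˢ s)   f             → av s f
    (refl ∷ s) (f2143 _ b c) → two-above b c (lookup s (there (here refl)))
    (refl ∷ s) (f2341 _ b c) → two-above b c (lookup s (there (here refl)))
    (refl ∷ s) (f2413 _ b c) → two-above b c (lookup s (here refl))
  where
  two-above : v < x → x < y → y ∈ σ → ⊥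
  two-above v<x x<y y∈σ = <-irrefl refl (≤-trans (bound y∈σ) (≤-trans (s≤s v<x) x<y))

-- In each pattern an earlier letter exceeds the last one.
avoiding-∷ʳ : ∀ σ → Avoiding σ → (∀ {x} → x ∈ σ → x < m) → Avoiding (σ ∷ʳ m)
avoiding-∷ʳ {m} σ av bound s f with ⊆-∷ʳ⁻ σ s
... | inj₁ s′ = av s′ f
... | inj₂ (w ∷ x ∷ y ∷ [] , refl , s′) = last-not-max f
  where
  last-not-max : ¬ Forbidden w x y m
  last-not-max (f2143 _ _ m<y) = <-asym m<y (bound (lookup s′ (there (there (here refl)))))
  last-not-max (f2341 m<w _ _) = <-asym m<w (bound (lookup s′ (here refl)))
  last-not-max (f2413 _ _ m<x) = <-asym m<x (bound (lookup s′ (there (here refl))))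
... | inj₂ ([] , () , _)
... | inj₂ (_ ∷ [] , () , _)
... | inj₂ (_ ∷ _ ∷ [] , () , _)
... | inj₂ (_ ∷ _ ∷ _ ∷ _ ∷ [] , () , _)
... | inj₂ (_ ∷ _ ∷ _ ∷ _ ∷ _ ∷ _ , () , _)

-- Recursive generation of the avoiders.

Avoider : ℕ → List ℕ → Set
Avoider n l = Perm n l × Avoiding l

-- avoiders k lists the avoiders with letters 0, …, k; the other three list
-- avoiders with letters 0, …, k + 1 according to the position of k + 1.
-- A pair (v , τ) in maxSecond k stands for v ∷ suc k ∷ τ, with v nonzero.

avoiders maxNotLast maxInside : ℕ → List (List ℕ)
maxSecond : ℕ → List (ℕ × List ℕ)

avoiders zero    = (0 ∷ []) ∷ []
avoiders (suc k) = map (_∷ʳ suc k) (avoiders k) ++ maxNotLast k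

maxNotLast k = map (suc k ∷_) (avoiders k) ++ maxInside k

maxSecond zero    = []
maxSecond (suc k) = map (λ (v , τ) → v , suc k ∷ τ) (maxSecond k) ++ map (suc k ,_) (avoiders k)

maxInside zero    = []
maxInside (suc k) = map (0 ◂_) (maxNotLast k) ++
                    map (λ (v , τ) → v ∷ 2 + k ∷ τ) (maxSecond (suc k)) ++
                    map (suc k ◂_) (maxInside k)

NotLast Interior : ℕ → List ℕ → Set
NotLast m l = ∃ λ σ → ∃₂ λ c τ → l ≡ σ ++ m ∷ c ∷ τ
Interior m l = ∃₂ λ v τ → l ≡ v ∷ τ × NotLast m τ

interior⇒notLast : Interior m σ → NotLast m σ
interior⇒notLast (v , _ , refl , σ , c , τ , refl) = v ∷ σ , c , τ , refl

-- A letter in front gives the maximum a predecessor, so not being last is enough for it to become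
-- interior.
interior-◂ : skip v m ≡ n → NotLast m σ → Interior n (v ◂ σ)
interior-◂ {v = v} refl (σ , c , τ , refl) =
  v , _ , refl , map (skip v) σ , skip v c , map (skip v) τ , List.map-++ (skip v) σ (_ ∷ c ∷ τ)

perm-nonempty : Perm (suc n) σ → ∃₂ λ c τ → σ ≡ c ∷ τ
perm-nonempty {σ = []}    p with () ← ↭-length p
perm-nonempty {σ = c ∷ τ} _ = c , τ , refl

perm-tail-nonempty : Perm (2 + n) (v ∷ σ) → ∃₂ λ c τ → σ ≡ c ∷ τ
perm-tail-nonempty {σ = []}    p with () ← ↭-length p
perm-tail-nonempty {σ = c ∷ τ} _ = c , τ , refl

-- Soundness of the generated lists.

avoider-max∷ : Avoider n σ → Avoider (suc n) (n ∷ σ)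
avoider-max∷ (p , av) = perm-insert⁺ [] p , avoiding-large∷ av (m<n⇒m<1+n ∘ m<n⇒m<1+n ∘ perm⇒< p)

avoider-∷ʳmax : Avoider n σ → Avoider (suc n) (σ ∷ʳ n)
avoider-∷ʳmax {σ = σ} (p , av) =
  perm-insert⁺ σ (subst (Perm _) (sym (List.++-identityʳ σ)) p) ,
  avoiding-∷ʳ σ av (perm⇒< p)

avoider-0◂ : Avoider n σ → Avoider (suc n) (0 ◂ σ)
avoider-0◂ (p , av) = perm-◂⁺ z≤n p , avoiding-0∷ (avoiding-skip⁺ 0 av)

-- Only `suc n` exceeds the new first letter `n`, and a pattern needs two letters above its first.
avoider-penultimate◂ : Avoider (suc n) σ → Avoider (2 + n) (n ◂ σ)
avoider-penultimate◂ {n} (p , av) = q , avoiding-large∷ (avoiding-skip⁺ n av) (perm⇒< q ∘ there)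
  where q = perm-◂⁺ (n≤1+n n) p

avoider-penultimate∷max∷ : Avoider n σ → Avoider (2 + n) (n ∷ suc n ∷ σ)
avoider-penultimate∷max∷ {n} (p , av) =
  q , avoiding-large∷
        (avoiding-large∷ av (m<n⇒m<1+n ∘ m<n⇒m<1+n ∘ m<n⇒m<1+n ∘ perm⇒< p))
        (perm⇒< q ∘ there)
  where
  q = perm-insert⁺ (n ∷ []) (perm-insert⁺ [] p)

-- The one new danger is a 2413 that starts with `v` and has the new maximum as its 4. Its 1 lies
-- below `v`, so it is not `m`; the 1 and the 3 then both lie in `σ`, and `m` can replace the 4,
-- giving a pattern in the old word.
avoider-insert-second : v < m → Avoider (suc m) (v ∷ m ∷ σ) → Avoider (2 + m) (v ∷ suc m ∷ m ∷ σ)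
avoider-insert-second {v} {m} {σ} v<m (p , av) = perm-insert⁺ (v ∷ []) p , av′
  where
  m∉σ : m ∉ σ
  m∉σ m∈σ with (_ ∷ m∉ ∷ _) ← perm⇒unique p = All.lookup m∉ m∈σ refl
  <m : x ∈ σ → x < m
  <m x∈σ = ≤∧≢⇒< (≤-pred (perm⇒< p (there (there x∈σ)))) λ { refl → m∉σ x∈σ }
  av′ : Avoiding (v ∷ suc m ∷ m ∷ σ)
  av′ (_ ∷ˢ s) f = avoiding-large∷ (avoiding-⊆ (v ∷ˢ ⊆-refl) av)
    (m<n⇒m<1+n ∘ m<n⇒m<1+n ∘ perm⇒< p ∘ there) s f
  av′ (refl ∷ (_ ∷ˢ s)) f = av (refl ∷ s) f
  av′ (refl ∷ (refl ∷ s)) (f2143 1+m<v _ _) = <-asym (m<n⇒m<1+n v<m) 1+m<v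
  av′ (refl ∷ (refl ∷ s)) (f2341 _ _ 1+m<y) = <-asym 1+m<y (perm⇒< p (there (lookup s (here refl))))
  av′ (refl ∷ (refl ∷ (refl ∷ s))) (f2413 m<v _ _) = <-asym v<m m<v
  av′ (refl ∷ (refl ∷ (_ ∷ˢ s))) (f2413 y<v v<z _) =
    av (refl ∷ refl ∷ s) (f2413 y<v v<z (<m (lookup s (there (here refl)))))

avoiders-sound : ∀ k → All (Avoider (suc k)) (avoiders k)
maxNotLast-sound : ∀ k → All (λ σ → Avoider (2 + k) σ × NotLast (suc k) σ) (maxNotLast k)
maxInside-sound : ∀ k → All (λ σ → Avoider (2 + k) σ × Interior (suc k) σ) (maxInside k)
-- The bounds on `v` also keep blocks apart: `0 < v` excludes words that start with 0, and `v ≤ k`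
-- separates the two blocks of `maxSecond (suc k)`. Inserting a further maximum uses `v ≤ k` as
-- well.
maxSecond-sound : ∀ k →
  All (λ (v , τ) → Avoider (2 + k) (v ∷ suc k ∷ τ) × 0 < v × v ≤ k) (maxSecond k)

avoiders-sound zero    = (↭-refl , λ { (_ ∷ˢ ()) ; (refl ∷ ()) }) ∷ []
avoiders-sound (suc k) = All.++⁺
  (All.map⁺ (All.map avoider-∷ʳmax (avoiders-sound k)))
  (All.map proj₁ (maxNotLast-sound k))

maxNotLast-sound k = All.++⁺
  (All.map⁺ (All.map prepended (avoiders-sound k)))
  (All.map (λ (av , int) → av , interior⇒notLast int) (maxInside-sound k))
  where
  prepended : Avoider (suc k) σ → Avoider (2 + k) (suc k ∷ σ) × NotLast (suc k) (suc k ∷ σ)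
  prepended av with c , τ , refl ← perm-nonempty (proj₁ av) = avoider-max∷ av , [] , c , τ , refl

maxInside-sound zero    = []
maxInside-sound (suc k) =
  All.++⁺ (All.map⁺ (All.map least (maxNotLast-sound k)))
    (All.++⁺ (All.map⁺ (All.map second (maxSecond-sound (suc k))))
      (All.map⁺ (All.map penultimate (maxInside-sound k))))
  where
  least : Avoider (2 + k) σ × NotLast (suc k) σ → Avoider (3 + k) (0 ◂ σ) × Interior (2 + k) (0 ◂ σ)
  least (av , nl) = avoider-0◂ av , interior-◂ refl nl
  second : Avoider (3 + k) (v ∷ 2 + k ∷ τ) × 0 < v × v ≤ suc k →
           Avoider (3 + k) (v ∷ 2 + k ∷ τ) × Interior (2 + k) (v ∷ 2 + k ∷ τ)
  second {v} (av , _) with c , _ , refl ← perm-tail-nonempty (perm-insert⁻ (v ∷ []) (proj₁ av)) =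
    av , v , _ , refl , [] , c , _ , refl
  penultimate : Avoider (2 + k) σ × Interior (suc k) σ →
                Avoider (3 + k) (suc k ◂ σ) × Interior (2 + k) (suc k ◂ σ)
  penultimate (av , int) =
    avoider-penultimate◂ av , interior-◂ (v≤x⇒skip≡1+x ≤-refl) (interior⇒notLast int)

maxSecond-sound zero    = []
maxSecond-sound (suc k) = All.++⁺
  (All.map⁺ (All.map inserted (maxSecond-sound k)))
  (All.map⁺ (All.map (λ av → avoider-penultimate∷max∷ av , z<s , ≤-refl) (avoiders-sound k)))
  where
  inserted : Avoider (2 + k) (v ∷ suc k ∷ τ) × 0 < v × v ≤ k →
             Avoider (3 + k) (v ∷ 2 + k ∷ suc k ∷ τ) × 0 < v × v ≤ suc k
  inserted (av , 0<v , v≤k) = avoider-insert-second (s≤s v≤k) av , 0<v , m≤n⇒m≤1+n v≤k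

-- Completeness of the generated lists.

avoider-delete-max : ∀ σ → Avoider (suc n) (σ ++ n ∷ τ) → Avoider n (σ ++ τ)
avoider-delete-max σ (p , av) = perm-insert⁻ σ p , avoiding-⊆ (++⁺ {as = σ} ⊆-refl (_ ∷ˢ ⊆-refl)) av

perm-≢ : Perm n (v ∷ σ) → x ∈ σ → x ≢ v
perm-≢ p x∈σ refl with (v∉ ∷ _) ← perm⇒unique p = All.lookup v∉ x∈σ refl

perm-∈ : Perm n (v ∷ σ) → x < n → x ≢ v → x ∈ σ
perm-∈ p x<n x≢v with perm⇒∈ p x<n
... | here x≡v  = contradiction x≡v x≢v
... | there x∈σ = x∈σ

-- In the next two lemmas 0 and suc k are letters below and above v, and if
-- the conclusion fails they form a pattern with v wherever they stand.

after-max : Avoider (3 + k) (v ∷ 2 + k ∷ x ∷ τ) → 0 < v → v < suc k → x ≡ suc k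
after-max {k} {v} {x} {τ} (p , av) 0<v v<h with x ≟ suc k
... | yes x≡h = x≡h
... | no  x≢h = ⊥-elim impossible
  where
  p′ : Perm (2 + k) (v ∷ x ∷ τ)
  p′ = perm-insert⁻ (v ∷ []) p
  x<h : x < suc k
  x<h = ≤∧≢⇒< (≤-pred (perm⇒< p′ (there (here refl)))) x≢h
  h∈τ : suc k ∈ τ
  h∈τ with perm-∈ p′ ≤-refl (>⇒≢ v<h)
  ... | here h≡x  = contradiction (sym h≡x) x≢h
  ... | there h∈τ = h∈τ
  impossible : ⊥
  impossible with <-cmp x v
  ... | tri< x<v _ _ = av (refl ∷ refl ∷ refl ∷ from∈ h∈τ) (f2413 x<v v<h ≤-refl)
  ... | tri≈ _ x≡v _ = perm-≢ p′ (here refl) x≡v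
  ... | tri> _ _ v<x with perm-∈ p′ z<s (<⇒≢ 0<v)
  ...   | here refl with () ← v<x
  ...   | there 0∈τ with ∈-pair⊆ 0∈τ h∈τ (λ ())
  ...     | inj₁ 0,h = av (refl ∷ refl ∷ (x ∷ˢ 0,h)) (f2413 0<v v<h ≤-refl)
  ...     | inj₂ h,0 = av (refl ∷ (_ ∷ˢ (refl ∷ h,0))) (f2341 0<v v<x x<h)

before-interior-max : ∀ σ → Avoider (3 + k) (v ∷ w ∷ σ ++ 2 + k ∷ x ∷ τ) → 0 < v → v ≡ suc k
before-interior-max {k} {v} {w} {x} {τ} σ (p , av) 0<v with v ≟ suc k
... | yes v≡h = v≡h
... | no  v≢h = ⊥-elim (impossible (split z<s (<⇒≢ 0<v)) (split ≤-refl (v≢h ∘ sym)))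
  where
  p′ : Perm (2 + k) (v ∷ w ∷ σ ++ x ∷ τ)
  p′ = perm-insert⁻ (v ∷ w ∷ σ) p
  v<h : v < suc k
  v<h = ≤∧≢⇒< (≤-pred (perm⇒< p′ (here refl))) v≢h
  split : y < 2 + k → y ≢ v → y ∈ w ∷ σ ⊎ y ∈ x ∷ τ
  split y< y≢v = ∈-++⁻ (w ∷ σ) (perm-∈ p′ y< y≢v)
  x<m : x < 2 + k
  x<m = perm⇒< p′ (∈-++⁺ʳ (v ∷ w ∷ σ) (here refl))
  w<m : w < 2 + k
  w<m = perm⇒< p′ (there (here refl))
  w≢v : w ≢ v
  w≢v = perm-≢ p′ (here refl)
  x≢v : x ≢ v
  x≢v = perm-≢ p′ (∈-++⁺ʳ (w ∷ σ) (here refl))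
  around : y ∈ w ∷ σ → z ∈ x ∷ τ → ¬ Forbidden v y (2 + k) z
  around y∈ z∈ = av (refl ∷ ++⁺ (from∈ y∈) (refl ∷ from∈ z∈))
  after : y ∷ z ∷ [] ⊆ x ∷ τ → ¬ Forbidden v (2 + k) y z
  after s = av (refl ∷ ++⁺ˡ (w ∷ σ) (refl ∷ s))
  -- The cases are the sides of the maximum on which 0 and `suc k` stand. If both precede it, `x`
  -- supplies the last letter of the pattern; if both follow it with `suc k` first, `w` supplies the
  -- second.
  impossible : 0 ∈ w ∷ σ ⊎ 0 ∈ x ∷ τ → suc k ∈ w ∷ σ ⊎ suc k ∈ x ∷ τ → ⊥
  impossible (inj₁ 0∈) (inj₁ h∈) with <-cmp x v
  ... | tri< x<v _ _ = around h∈ (here refl) (f2341 x<v v<h ≤-refl)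
  ... | tri≈ _ x≡v _ = x≢v x≡v
  ... | tri> _ _ v<x = around 0∈ (here refl) (f2143 0<v v<x x<m)
  impossible (inj₁ 0∈) (inj₂ h∈) = around 0∈ h∈ (f2143 0<v v<h ≤-refl)
  impossible (inj₂ 0∈) (inj₁ h∈) = around h∈ 0∈ (f2341 0<v v<h ≤-refl)
  impossible (inj₂ 0∈) (inj₂ h∈) with ∈-pair⊆ 0∈ h∈ (λ ())
  ... | inj₁ 0,h = after 0,h (f2413 0<v v<h ≤-refl)
  ... | inj₂ h,0 with <-cmp w v
  ...   | tri< w<v _ _ = around (here refl) h∈ (f2143 w<v v<h ≤-refl)
  ...   | tri≈ _ w≡v _ = w≢v w≡v
  ...   | tri> _ _ v<w = around (here refl) 0∈ (f2341 0<v v<w w<m)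

avoider-◂⁻ : Avoider (suc n) (v ∷ τ) → ∃ λ σ → τ ≡ map (skip v) σ × Avoider n σ
avoider-◂⁻ {v = v} (p , av) with σ , refl , q ← perm-◂⁻ p =
  σ , refl , q , avoiding-skip⁻ v (avoiding-⊆ (v ∷ˢ ⊆-refl) av)

-- `skip v` sends only `m` to `suc m`, so the split pulls back. The equation of lengths tells the
-- caller that a nonempty prefix stays nonempty.
notLast-◂⁻ : ∀ v σ → v ≤ m → map (skip v) τ ≡ σ ++ suc m ∷ x ∷ υ →
             ∃ λ σ′ → ∃₂ λ x′ υ′ → τ ≡ σ′ ++ m ∷ x′ ∷ υ′ × length σ ≡ length σ′
notLast-◂⁻ {m} {τ} v σ v≤m eq with map-++-∷⁻ (skip v) τ σ eq
... | σ′ , m′ , x′ ∷ υ′ , refl , refl , m≡ , refl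
  with refl ← skip-injective v (trans (v≤x⇒skip≡1+x v≤m) m≡) =
  σ′ , x′ , υ′ , refl , List.length-map (skip v) σ′

avoiders-complete : ∀ k → Avoider (suc k) σ → σ ∈ avoiders k
-- The word comes split around its maximum, so that matching on the prefix decides the block.
maxNotLast-complete : ∀ k σ → Avoider (2 + k) (σ ++ suc k ∷ x ∷ τ) →
                      σ ++ suc k ∷ x ∷ τ ∈ maxNotLast k
maxInside-complete : ∀ k v σ → Avoider (2 + k) (v ∷ σ ++ suc k ∷ x ∷ τ) →
                     v ∷ σ ++ suc k ∷ x ∷ τ ∈ maxInside k
maxSecond-complete : ∀ k → Avoider (2 + k) (v ∷ suc k ∷ τ) → 0 < v → (v , τ) ∈ maxSecond k

avoiders-complete zero    (p , _) = here (↭-singleton-inv (↭-sym p))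
avoiders-complete (suc k) av with ∈-∃++ (perm⇒∈ (proj₁ av) ≤-refl)
... | σ , []    , refl = ∈-++⁺ˡ (∈-map⁺ _ (avoiders-complete k
  (subst (Avoider (suc k)) (List.++-identityʳ σ) (avoider-delete-max σ av))))
... | σ , _ ∷ _ , refl = ∈-++⁺ʳ (map _ (avoiders k)) (maxNotLast-complete k σ av)

maxNotLast-complete k []      av =
  ∈-++⁺ˡ (∈-map⁺ _ (avoiders-complete k (avoider-delete-max [] av)))
maxNotLast-complete k (v ∷ σ) av = ∈-++⁺ʳ _ (maxInside-complete k v σ av)

-- An interior maximum requires three letters, but here there are only two.
maxInside-complete zero v σ (p , _)
  with () ← ↭-length (↭-trans (perm-insert⁻ (v ∷ σ) p) (shift _ (v ∷ σ) _))
maxInside-complete (suc k) zero    σ av with avoider-◂⁻ av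
... | ρ , eq , av′ with notLast-◂⁻ 0 σ z≤n (sym eq)
... | σ′ , _ , _ , refl , _ =
  subst (λ τ → 0 ∷ τ ∈ maxInside (suc k)) (sym eq)
    (∈-++⁺ˡ (∈-map⁺ (0 ◂_) (maxNotLast-complete k σ′ av′)))
maxInside-complete (suc k) (suc v) [] av =
  ∈-++⁺ʳ (map _ (maxNotLast k)) (∈-++⁺ˡ (∈-map⁺ _ (maxSecond-complete (suc k) av z<s)))
maxInside-complete (suc k) (suc v) (w ∷ σ) av with before-interior-max σ av z<s
... | refl with avoider-◂⁻ av
... | ρ , eq , av′ with notLast-◂⁻ (suc k) (w ∷ σ) ≤-refl (sym eq)
... | v′ ∷ σ′ , _ , _ , refl , _ =
  subst (λ τ → suc k ∷ τ ∈ maxInside (suc k)) (sym eq)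
    (∈-++⁺ʳ (map _ (maxNotLast k)) (∈-++⁺ʳ (map _ (maxSecond (suc k)))
      (∈-map⁺ (suc k ◂_) (maxInside-complete k v′ σ′ av′))))

-- With letters 0 and 1 only, a positive `v` would repeat the maximum.
maxSecond-complete zero (p , _) 0<v =
  contradiction (≤-antisym (≤-pred (perm⇒< p (here refl))) 0<v) (perm-≢ p (here refl) ∘ sym)
maxSecond-complete {v} (suc k) av 0<v with v ≟ suc k
... | yes refl = ∈-++⁺ʳ (map _ (maxSecond k)) (∈-map⁺ _ (avoiders-complete k
  (avoider-delete-max [] (avoider-delete-max (suc k ∷ []) av))))
-- By `after-max` the maximum is followed by `suc k`, so deleting it leaves a word whose own maximum
-- is again second.
... | no v≢h with p ← perm-insert⁻ (v ∷ []) (proj₁ av) with perm-tail-nonempty p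
... | x , τ , refl
  with refl ← after-max av 0<v (≤∧≢⇒< (≤-pred (perm⇒< p (here refl))) v≢h) =
  ∈-++⁺ˡ (∈-map⁺ _ (maxSecond-complete k (avoider-delete-max (v ∷ []) av) 0<v))

-- Absence of repetitions.

-- Blocks are told apart by the position of the maximum or by the first letter.
avoiders-unique : ∀ k → Unique (avoiders k)
maxNotLast-unique : ∀ k → Unique (maxNotLast k)
maxInside-unique : ∀ k → Unique (maxInside k)
maxSecond-unique : ∀ k → Unique (maxSecond k)

avoiders-unique zero    = [] ∷ []
avoiders-unique (suc k) = Unique.++⁺
  (Unique.map⁺ (List.∷ʳ-injectiveˡ _ _) (avoiders-unique k)) (maxNotLast-unique k) disjoint
  where
  disjoint : Disjoint (map (_∷ʳ suc k) (avoiders k)) (maxNotLast k)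
  disjoint (l∈ , l∈′) with σ , _ , refl ← ∈-map⁻ _ l∈
    with (p , _) , σ′ , _ , _ , eq ← All.lookup (maxNotLast-sound k) l∈′
    -- The maximum occurs once, so the two splittings around it agree; but only one of them has an
    -- empty suffix.
    with () ← proj₂ (++-∷-unique {xs = σ} (perm-insert-∉ˡ σ p)
                       (perm-insert-∉ˡ σ′ (subst (Perm _) eq p)) eq)

maxNotLast-unique k = Unique.++⁺
  (Unique.map⁺ List.∷-injectiveʳ (avoiders-unique k)) (maxInside-unique k) disjoint
  where
  disjoint : Disjoint (map (suc k ∷_) (avoiders k)) (maxInside k)
  disjoint (l∈ , l∈′) with σ , _ , refl ← ∈-map⁻ _ l∈
    with (p , _) , v , _ , eq , σ′ , _ , _ , refl ← All.lookup (maxInside-sound k) l∈′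
    with () ← proj₁ (++-∷-unique {xs = []} (λ ())
                       (perm-insert-∉ˡ (v ∷ σ′) (subst (Perm _) eq p)) eq)

maxInside-unique zero    = []
maxInside-unique (suc k) =
  Unique.++⁺ (Unique.map⁺ (◂-injective 0) (maxNotLast-unique k))
    (Unique.++⁺ (Unique.map⁺ (λ { refl → refl }) (maxSecond-unique (suc k)))
      (Unique.map⁺ (◂-injective (suc k)) (maxInside-unique k))
      second-or-later)
    zero-or-positive
  where
  ◂-injective : ∀ v → v ◂ σ ≡ v ◂ τ → σ ≡ τ
  ◂-injective v eq = List.map-injective (skip-injective v) (List.∷-injectiveʳ eq)
  second-or-later : Disjoint (map (λ (v , τ) → v ∷ 2 + k ∷ τ) (maxSecond (suc k)))
                             (map (suc k ◂_) (maxInside k))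
  second-or-later (l∈ , l∈′) with σ , σ∈ , refl ← ∈-map⁻ _ l∈′ with _ , _ , eq ← ∈-map⁻ _ l∈
    with (p , _) , v , _ , refl , σ′ , _ , _ , refl ← All.lookup (maxInside-sound k) σ∈ =
    -- Equality would make `2 + k` the image of `v`, hence `v ≡ suc k`; but `suc k` is the maximum
    -- of that word and stands further right.
    perm-insert-∉ˡ (v ∷ σ′) p (here (skip-injective (suc k)
      (trans (v≤x⇒skip≡1+x ≤-refl) (sym (List.∷-injectiveˡ (List.∷-injectiveʳ eq))))))
  zero-or-positive : Disjoint (map (0 ◂_) (maxNotLast k))
                              (map _ (maxSecond (suc k)) ++ map (suc k ◂_) (maxInside k))
  zero-or-positive (l∈ , l∈′) with σ , _ , refl ← ∈-map⁻ _ l∈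
    with ∈-++⁻ (map _ (maxSecond (suc k))) l∈′
  ... | inj₁ l∈ with _ , p∈ , eq ← ∈-map⁻ _ l∈
    with _ , 0<v , _ ← All.lookup (maxSecond-sound (suc k)) p∈ = <⇒≢ 0<v (List.∷-injectiveˡ eq)
  ... | inj₂ l∈ with _ , _ , () ← ∈-map⁻ _ l∈

maxSecond-unique zero    = []
maxSecond-unique (suc k) =
  Unique.++⁺ (Unique.map⁺ (λ { refl → refl }) (maxSecond-unique k))
    (Unique.map⁺ ,-injectiveʳ (avoiders-unique k)) disjoint
  where
  disjoint : Disjoint (map (λ (v , τ) → v , suc k ∷ τ) (maxSecond k)) (map (suc k ,_) (avoiders k))
  disjoint (p∈ , p∈′) with (_ , _) , q∈ , refl ← ∈-map⁻ _ p∈ with _ , _ , refl ← ∈-map⁻ _ p∈′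
    with _ , _ , v≤k ← All.lookup (maxSecond-sound k) q∈ = <-irrefl refl v≤k

-- Counting.

length-map-++ : ∀ (f : A → B) xs ys → length (map f xs ++ ys) ≡ length xs + length ys
length-map-++ f xs ys =
  trans (List.length-++ (map f xs)) (cong (_+ length ys) (List.length-map f xs))

-- Index shift: `avoiders k` holds words of length `k + 1`, while `maxInside k` and `maxSecond k`
-- concern length `k + 2`.
length-avoiders : ∀ k → length (avoiders (suc k)) ≡ 2 ℕ.* length (avoiders k) + length (maxInside k)
length-avoiders k = trans (length-map-++ _ (avoiders k) _)
  (trans (cong (ℕ._+_ (length (avoiders k))) (length-map-++ _ (avoiders k) _))
    (lemma (length (avoiders k)) (length (maxInside k))))
  where
  lemma : ∀ y m → y + (y + m) ≡ 2 ℕ.* y + m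
  lemma = ℕSolver.solve-∀

length-maxSecond : ∀ k → length (maxSecond (suc k)) ≡ length (maxSecond k) + length (avoiders k)
length-maxSecond k = trans (length-map-++ _ (maxSecond k) _) (cong (ℕ._+_ (length (maxSecond k)))
    (List.length-map _ (avoiders k)))

length-maxInside : ∀ k → length (maxInside (suc k)) ≡
  2 ℕ.* length (avoiders k) + 2 ℕ.* length (maxInside k) + length (maxSecond k)
length-maxInside k = trans (length-map-++ _ (maxNotLast k) _)
  (trans (cong₂ _+_ (length-map-++ _ (avoiders k) _)
           (trans (length-map-++ _ (maxSecond (suc k)) _)
             (cong₂ _+_ (length-maxSecond k) (List.length-map _ (maxInside k)))))
         (lemma (length (avoiders k)) (length (maxInside k)) (length (maxSecond k))))
  where
  lemma : ∀ y m d → (y + m) + ((d + y) + m) ≡ 2 ℕ.* y + 2 ℕ.* m + d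
  lemma = ℕSolver.solve-∀

-- The three lengths at `k` determine all later ones linearly, so this is an identity in three free
-- variables. The term with 6 stands on the left to avoid subtraction in ℕ.
length-recurrence : ∀ k → length (avoiders (3 + k)) + 6 ℕ.* length (avoiders (1 + k)) ≡
  5 ℕ.* length (avoiders (2 + k)) + 3 ℕ.* length (avoiders k)
length-recurrence k
  rewrite length-avoiders (2 + k) | length-avoiders (1 + k) | length-maxInside (1 + k)
        | length-maxInside k | length-maxSecond k | length-avoiders k
  = lemma (length (avoiders k)) (length (maxInside k)) (length (maxSecond k))
  where
  lemma : ∀ y m d →
    let y₁ = 2 ℕ.* y + m
        m₁ = 2 ℕ.* y + 2 ℕ.* m + d
        d₁ = d + y
        y₂ = 2 ℕ.* y₁ + m₁
        m₂ = 2 ℕ.* y₁ + 2 ℕ.* m₁ + d₁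
        y₃ = 2 ℕ.* y₂ + m₂
    in y₃ + 6 ℕ.* y₁ ≡ 5 ℕ.* y₂ + 3 ℕ.* y
  lemma = ℕSolver.solve-∀

-- Words as lists of letters.

letters : Word n k → List ℕ
letters = map toℕ ∘ toList

letters-injective : {π ρ : Word n k} → letters π ≡ letters ρ → π ≡ ρ
letters-injective {π = []}    {[]}    _  = refl
letters-injective {π = i ∷ π} {j ∷ ρ} eq =
  cong₂ _∷_ (Fin.toℕ-injective (List.∷-injectiveˡ eq)) (letters-injective (List.∷-injectiveʳ eq))

letters-surjective : ∀ σ → (∀ {x} → x ∈ σ → x < n) → ∃ λ (π : Word n (length σ)) → letters π ≡ σ
letters-surjective []      _     = [] , refl
letters-surjective (x ∷ σ) bound with π , eq ← letters-surjective σ (bound ∘ there) =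
  fromℕ< (bound (here refl)) ∷ π , cong₂ _∷_ (Fin.toℕ-fromℕ< _) eq

toList-unique⁺ : (xs : Vec A n) → Injective _≡_ _≡_ (Vec.lookup xs) → Unique (toList xs)
toList-unique⁺ []       _   = []
toList-unique⁺ (x ∷ xs) inj =
  VecAll.toList⁺ (VecAll.lookup⁻ λ i eq → contradiction (inj {zero} {suc i} eq) λ ())
  ∷ toList-unique⁺ xs (Fin.suc-injective ∘ inj)

toList-unique⁻ : (xs : Vec A n) → Unique (toList xs) → Injective _≡_ _≡_ (Vec.lookup xs)
toList-unique⁻ (x ∷ xs) (x∉ ∷ u) {zero}  {zero}  eq = refl
toList-unique⁻ (x ∷ xs) (x∉ ∷ u) {zero}  {suc j} eq =
  contradiction eq (VecAll.lookup⁺ (VecAll.toList⁻ x∉) j)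
toList-unique⁻ (x ∷ xs) (x∉ ∷ u) {suc i} {zero}  eq =
  contradiction (sym eq) (VecAll.lookup⁺ (VecAll.toList⁻ x∉) i)
toList-unique⁻ (x ∷ xs) (x∉ ∷ u) {suc i} {suc j} eq =
  cong suc (toList-unique⁻ xs u eq)

-- Two duplicate-free lists with the same members are permutations of each other; injectivity
-- excludes duplicates and surjectivity supplies every letter.
isPermutation⇒perm : (π : Word n n) → IsPermutation π → Perm n (letters π)
isPermutation⇒perm {n} π (inj , surj) = ∼bag⇒↭ (unique∧set⇒bag (Unique.downFrom⁺ n)
  (Unique.map⁺ Fin.toℕ-injective (toList-unique⁺ π inj)) (mk⇔ to from))
  where
  to : x ∈ downFrom n → x ∈ letters π
  to x∈ with x<n ← ∈-downFrom⁻ x∈ with i , eq ← surjective⇒strictlySurjective surj (fromℕ< x<n) =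
    subst (_∈ letters π) (trans (cong toℕ eq) (Fin.toℕ-fromℕ< x<n))
      (∈-map⁺ toℕ (Vec.∈-toList⁺ (Vec.∈-lookup i π)))
  from : x ∈ letters π → x ∈ downFrom n
  from x∈ with i , _ , refl ← ∈-map⁻ toℕ x∈ = ∈-downFrom⁺ (Fin.toℕ<n i)

perm⇒isPermutation : (π : Word n n) → Perm n (letters π) → IsPermutation π
perm⇒isPermutation π p =
  toList-unique⁻ π (Unique.map⁻ (perm⇒unique p)) , strictlySurjective⇒surjective surj
  where
  surj : StrictlySurjective _≡_ (Vec.lookup π)
  surj j with i , i∈ , eq ← ∈-map⁻ toℕ (perm⇒∈ p (Fin.toℕ<n j))
    with j≡ ← Fin.toℕ-injective eq =
    VecAny.index (Vec.∈-toList⁻ i∈) , trans (sym (VecAny.lookup-index (Vec.∈-toList⁻ i∈))) (sym j≡)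

-- Occurrences at positions and sublists.

subsequence : Vec A n → Vec (Fin n) k → Vec A k
subsequence xs = Vec.map (Vec.lookup xs)

Increasing : Vec (Fin n) k → Set
Increasing = VecAllPairs.AllPairs Fin._<_

positive⇒suc : (p : Vec (Fin (suc n)) k) → VecAll.All (zero {n} Fin.<_) p →
               ∃ λ q → p ≡ Vec.map suc q
positive⇒suc []          _                = [] , refl
positive⇒suc (suc i ∷ p) (_ VecAll.∷ pos) with q , refl ← positive⇒suc p pos = i ∷ q , refl

increasing-suc⁻ : (q : Vec (Fin n) k) → Increasing (Vec.map suc q) → Increasing q
increasing-suc⁻ []      _                       = VecAllPairs.[]
increasing-suc⁻ (i ∷ q) (i< VecAllPairs.∷ incr) =
  VecAll.map ≤-pred (VecAll.map⁻ i<) VecAllPairs.∷ increasing-suc⁻ q incr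

subsequence-suc : (x : A) (xs : Vec A n) (q : Vec (Fin n) k) →
                  subsequence (x ∷ xs) (Vec.map suc q) ≡ subsequence xs q
subsequence-suc x xs q = sym (Vec.map-∘ _ suc q)

-- An increasing list of positions either starts with `zero` or misses it altogether; these are the
-- keep and drop steps of a sublist.
subsequence-⊆ : (xs : Vec A n) (p : Vec (Fin n) k) → Increasing p →
                toList (subsequence xs p) ⊆ toList xs
subsequence-⊆ []       []         _    = []
subsequence-⊆ (x ∷ xs) []         _    = minimum _
subsequence-⊆ (x ∷ xs) (zero ∷ p) (0< VecAllPairs.∷ incr) with q , refl ← positive⇒suc p 0< =
  refl ∷ subst (λ s → toList s ⊆ toList xs) (sym (subsequence-suc x xs q))
           (subsequence-⊆ xs q (increasing-suc⁻ q incr))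
subsequence-⊆ (x ∷ xs) (suc i ∷ p) incr@(i< VecAllPairs.∷ _)
  with q , refl ← positive⇒suc p (VecAll.map (≤-trans z<s) i<) =
  x ∷ˢ subst (λ s → toList s ⊆ toList xs) (sym (subsequence-suc x xs (i ∷ q)))
         (subsequence-⊆ xs (i ∷ q) (increasing-suc⁻ (i ∷ q) incr))

⊆-subsequence : (xs : Vec A n) {ys : List A} → ys ⊆ toList xs →
                ∃ λ (p : Vec (Fin n) (length ys)) → Increasing p × toList (subsequence xs p) ≡ ys
⊆-subsequence []       []         = [] , VecAllPairs.[] , refl
⊆-subsequence (x ∷ xs) (_ ∷ˢ s) with p , incr , eq ← ⊆-subsequence xs s =
  Vec.map suc p , VecAllPairs.map⁺ (VecAllPairs.map s<s incr) ,
  trans (cong toList (subsequence-suc x xs p)) eq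
⊆-subsequence (x ∷ xs) (refl ∷ s) with p , incr , eq ← ⊆-subsequence xs s =
  zero ∷ Vec.map suc p ,
  VecAll.map⁺ (VecAll.universal (λ _ → z<s) p) VecAllPairs.∷
    VecAllPairs.map⁺ (VecAllPairs.map s<s incr) ,
  cong (x ∷_) (trans (cong toList (subsequence-suc x xs p)) eq)

-- Extends 1, 2, 3, 4 ↦ a, b, c, d, shifted by one to leave room for the
-- image of 0, to a map that is strictly increasing on all of ℕ.

extend : (a b c d : ℕ) → ℕ → ℕ
extend a b c d 0 = 0
extend a b c d 1 = suc a
extend a b c d 2 = suc b
extend a b c d 3 = suc c
extend a b c d (suc (suc (suc (suc i)))) = suc (i + d)

extend-step : ∀ {a b c d} → a < b → b < c → c < d → ∀ i → extend a b c d i < extend a b c d (suc i)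
extend-step a<b b<c c<d 0 = z<s
extend-step a<b b<c c<d 1 = s<s a<b
extend-step a<b b<c c<d 2 = s<s b<c
extend-step a<b b<c c<d 3 = s<s c<d
extend-step a<b b<c c<d (suc (suc (suc (suc i)))) = ≤-refl

step⇒mono : {h : ℕ → ℕ} → (∀ i → h i < h (suc i)) → ∀ {i j} → i < j → h i < h j
step⇒mono step {i} {suc j} i<1+j with m≤n⇒m<n∨m≡n (≤-pred i<1+j)
... | inj₁ i<j  = <-trans (step⇒mono step i<j) (step j)
... | inj₂ refl = step i

mono⇒cancel : {h : ℕ → ℕ} → (∀ {i j} → i < j → h i < h j) → ∀ {i j} → h i < h j → i < j
mono⇒cancel mono {i} {j} hi<hj with <-cmp i j
... | tri< i<j _ _  = i<j
... | tri≈ _ refl _ = contradiction hi<hj (<-irrefl refl)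
... | tri> _ _ j<i  = contradiction hi<hj (<-asym (mono j<i))

-- `extend a b c d` preserves and reflects order, so one equation per position yields the
-- equivalence for all pairs of positions.
occursAt : ∀ {a b c d} → a < b → b < c → c < d →
           (τ : Pattern) (π : Word n n) (p : Word n (length τ)) →
           Increasing p →
           (∀ i → suc (toℕ (Vec.lookup π (Vec.lookup p i))) ≡ extend a b c d (List.lookup τ i)) →
           OccursAt τ π p
occursAt a<b b<c c<d τ π p incr eq = incr , λ i j → mk⇔
  (λ lt → mono⇒cancel mono (subst₂ _<_ (eq i) (eq j) (s<s lt)))
  (λ lt → ≤-pred (subst₂ _<_ (sym (eq i)) (sym (eq j)) (mono lt)))
  where mono = step⇒mono (extend-step a<b b<c c<d)

patterns : List Pattern
patterns = (2 ∷ 1 ∷ 4 ∷ 3 ∷ []) ∷ (2 ∷ 3 ∷ 4 ∷ 1 ∷ []) ∷ (2 ∷ 4 ∷ 1 ∷ 3 ∷ []) ∷ []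

-- Each constructor of `Forbidden` lists its inequalities by rising value, which is the chain that
-- `occursAt` expects; its equations then hold by computation.
avoids⇒avoiding : (π : Word n n) → Avoids patterns π → Avoiding (letters π)
avoids⇒avoiding π (no2143 ∷ no2341 ∷ no2413 ∷ []) s f with ⊆-map⁻ toℕ (toList π) s
... | _ ∷ _ ∷ _ ∷ _ ∷ [] , refl , s′ with ⊆-subsequence π s′
... | p@(_ ∷ _ ∷ _ ∷ _ ∷ []) , incr , refl with f
... | f2143 x<w w<z z<y = no2143 (p , occursAt x<w w<z z<y (2 ∷ 1 ∷ 4 ∷ 3 ∷ []) π p incr
  λ { 0F → refl ; 1F → refl ; 2F → refl ; 3F → refl })
... | f2341 z<w w<x x<y = no2341 (p , occursAt z<w w<x x<y (2 ∷ 3 ∷ 4 ∷ 1 ∷ []) π p incr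
  λ { 0F → refl ; 1F → refl ; 2F → refl ; 3F → refl })
... | f2413 y<w w<z z<x = no2413 (p , occursAt y<w w<z z<x (2 ∷ 4 ∷ 1 ∷ 3 ∷ []) π p incr
  λ { 0F → refl ; 1F → refl ; 2F → refl ; 3F → refl })

-- Comparing neighbouring values is enough: each use of `iso` takes the positions of two consecutive
-- pattern letters.
avoiding⇒avoids : (π : Word n n) → Avoiding (letters π) → Avoids patterns π
avoiding⇒avoids {n} π av = no2143 ∷ no2341 ∷ no2413 ∷ []
  where
  occurrence : {p : Word n k} → Increasing p → letters (subsequence π p) ⊆ letters π
  occurrence incr = ⊆-map⁺ toℕ (subsequence-⊆ π _ incr)
  1<2 : 1 < 2
  1<2 = ≤-refl
  2<3 : 2 < 3
  2<3 = ≤-refl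
  3<4 : 3 < 4
  3<4 = ≤-refl
  no2143 : ¬ Contains π (2 ∷ 1 ∷ 4 ∷ 3 ∷ [])
  no2143 (_ ∷ _ ∷ _ ∷ _ ∷ [] , incr , iso) = av (occurrence incr)
    (f2143 (Equivalence.from (iso 1F 0F) 1<2)
           (Equivalence.from (iso 0F 3F) 2<3)
           (Equivalence.from (iso 3F 2F) 3<4))
  no2341 : ¬ Contains π (2 ∷ 3 ∷ 4 ∷ 1 ∷ [])
  no2341 (_ ∷ _ ∷ _ ∷ _ ∷ [] , incr , iso) = av (occurrence incr)
    (f2341 (Equivalence.from (iso 3F 0F) 1<2)
           (Equivalence.from (iso 0F 1F) 2<3)
           (Equivalence.from (iso 1F 2F) 3<4))
  no2413 : ¬ Contains π (2 ∷ 4 ∷ 1 ∷ 3 ∷ [])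
  no2413 (_ ∷ _ ∷ _ ∷ _ ∷ [] , incr , iso) = av (occurrence incr)
    (f2413 (Equivalence.from (iso 2F 0F) 1<2)
           (Equivalence.from (iso 0F 3F) 2<3)
           (Equivalence.from (iso 3F 1F) 3<4))

-- `map f xs` is duplicate-free with the same members as `ys`, hence a permutation of it.
injection-length : {f : A → B} → Injective _≡_ _≡_ f → {xs : List A} {ys : List B} →
                   Unique xs → Unique ys → (∀ {x} → x ∈ xs → f x ∈ ys) →
                   (∀ {y} → y ∈ ys → ∃ λ x → x ∈ xs × y ≡ f x) → length xs ≡ length ys
injection-length {f = f} inj {xs} {ys} xs! ys! to from =
  trans (sym (List.length-map f xs))
        (↭-length (∼bag⇒↭ (unique∧set⇒bag (Unique.map⁺ inj xs!) ys! (mk⇔ to′ from′))))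
  where
  to′ : ∀ {y} → y ∈ map f xs → y ∈ ys
  to′ y∈ with x , x∈ , refl ← ∈-map⁻ f y∈ = to x∈
  from′ : ∀ {y} → y ∈ ys → y ∈ map f xs
  from′ y∈ with x , x∈ , refl ← from y∈ = ∈-map⁺ f x∈

avoider⇒word : Avoider n σ →
               ∃ λ (π : Word n n) → (IsPermutation π × Avoids patterns π) × σ ≡ letters π
avoider⇒word {n} {σ} (p , av) =
  word (trans (sym (↭-length p)) (List.length-downFrom n)) (letters-surjective σ (perm⇒< p))
  where
  -- The word found has length `length σ`; generalising this to `l` lets the equation with `n` be
  -- matched by `refl`.
  word : ∀ {l} → l ≡ n → ∃ (λ (π : Word n l) → letters π ≡ σ) →
         ∃ λ (π : Word n n) → (IsPermutation π × Avoids patterns π) × σ ≡ letters π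
  word refl (π , refl) = π , (perm⇒isPermutation π p , avoiding⇒avoids π av) , refl

length-S : ∀ k → length (S patterns (suc k)) ≡ length (avoiders k)
length-S k =
  injection-length letters-injective (S-unique patterns (suc k)) (avoiders-unique k)
    (λ {π} → word⇒avoider π ∘ Equivalence.to (∈-S patterns (suc k) π))
    (λ σ∈ → let π , πS , eq = avoider⇒word (All.lookup (avoiders-sound k) σ∈) in
            π , Equivalence.from (∈-S patterns (suc k) π) πS , eq)
  where
  word⇒avoider : (π : Word (suc k) (suc k)) → IsPermutation π × Avoids patterns π →
                 letters π ∈ avoiders k
  word⇒avoider π (perm , av) =
    avoiders-complete k (isPermutation⇒perm π perm , avoids⇒avoiding π av)

-- The generating function.

-- The constant term is separate because `avoiders` starts at length 1.
count : Series
count zero    = + 1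
count (suc k) = + length (avoiders k)

F≈count : F patterns ≈ count
F≈count zero    = refl
F≈count (suc k) = cong +_ (length-S k)

denominator : Series
denominator = polynomial (+ 1 ∷ - (+ 5) ∷ + 6 ∷ - (+ 3) ∷ [])

-- The equations for f say f = q · denominator; a step of the long division
-- preserves them.

quotient-recurrence : (f q : Series) →
  f 0 ≡ q 0 →
  f 1 ≡ q 1 ℤ.- + 5 ℤ.* q 0 →
  f 2 ≡ q 2 ℤ.- + 5 ℤ.* q 1 ℤ.+ + 6 ℤ.* q 0 →
  f 3 ≡ q 3 ℤ.- + 5 ℤ.* q 2 ℤ.+ + 6 ℤ.* q 1 ℤ.- + 3 ℤ.* q 0 →
  (∀ k → f (4 + k) ≡ + 0) →
  (∀ k → q (4 + k) ≡ + 5 ℤ.* q (3 + k) ℤ.- + 6 ℤ.* q (2 + k) ℤ.+ + 3 ℤ.* q (1 + k)) →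
  q ≈ quotient f denominator
quotient-recurrence f q f0 f1 f2 f3 f≥4 rec zero    = sym f0
quotient-recurrence f q f0 f1 f2 f3 f≥4 rec (suc n) =
  quotient-recurrence _ (q ∘ suc)
    (trans (cong₂ (λ a b → a ℤ.- b ℤ.* - (+ 5)) f1 f0) (head (q 0) (q 1)))
    (trans (cong₂ (λ a b → a ℤ.- b ℤ.* + 6) f2 f0) (second (q 0) (q 1) (q 2)))
    (trans (cong₂ (λ a b → a ℤ.- b ℤ.* - (+ 3)) f3 f0) (third (q 0) (q 1) (q 2) (q 3)))
    -- The new degree 3 coefficient comes from `f 4`, which is 0; `rec 0` puts this zero into the
    -- required form.
    (trans (cong₂ (λ a b → a ℤ.- b ℤ.* + 0) (f≥4 0) f0)
      (trans (fourth (q 0) (q 1) (q 2) (q 3))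
        (cong (λ a → a ℤ.- + 5 ℤ.* q 3 ℤ.+ + 6 ℤ.* q 2 ℤ.- + 3 ℤ.* q 1) (sym (rec 0)))))
    (λ k → trans (cong₂ (λ a b → a ℤ.- b ℤ.* + 0) (f≥4 (suc k)) f0) (rest (q 0)))
    (rec ∘ suc) n
  where
  head : ∀ a b → (b ℤ.- + 5 ℤ.* a) ℤ.- a ℤ.* - (+ 5) ≡ b
  head = ℤSolver.solve-∀
  second : ∀ a b c → (c ℤ.- + 5 ℤ.* b ℤ.+ + 6 ℤ.* a) ℤ.- a ℤ.* + 6 ≡ c ℤ.- + 5 ℤ.* b
  second = ℤSolver.solve-∀
  third : ∀ a b c d → (d ℤ.- + 5 ℤ.* c ℤ.+ + 6 ℤ.* b ℤ.- + 3 ℤ.* a) ℤ.- a ℤ.* - (+ 3) ≡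
          d ℤ.- + 5 ℤ.* c ℤ.+ + 6 ℤ.* b
  third = ℤSolver.solve-∀
  fourth : ∀ a b c d → + 0 ℤ.- a ℤ.* + 0 ≡
           (+ 5 ℤ.* d ℤ.- + 6 ℤ.* c ℤ.+ + 3 ℤ.* b) ℤ.- + 5 ℤ.* d ℤ.+ + 6 ℤ.* c ℤ.- + 3 ℤ.* b
  fourth = ℤSolver.solve-∀
  rest : ∀ a → + 0 ℤ.- a ℤ.* + 0 ≡ + 0
  rest = ℤSolver.solve-∀

count-recurrence : ∀ k → count (4 + k) ≡
  + 5 ℤ.* count (3 + k) ℤ.- + 6 ℤ.* count (2 + k) ℤ.+ + 3 ℤ.* count (1 + k)
count-recurrence k =
  solve (length (avoiders (3 + k))) (length (avoiders (2 + k)))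
        (length (avoiders (1 + k))) (length (avoiders k)) (length-recurrence k)
  where
  open ≡-Reasoning
  add-subtract : ∀ a b → a ≡ (a ℤ.+ + 6 ℤ.* b) ℤ.- + 6 ℤ.* b
  add-subtract = ℤSolver.solve-∀
  rearrange : ∀ b c d → (+ 5 ℤ.* c ℤ.+ + 3 ℤ.* d) ℤ.- + 6 ℤ.* b ≡
              + 5 ℤ.* c ℤ.- + 6 ℤ.* b ℤ.+ + 3 ℤ.* d
  rearrange = ℤSolver.solve-∀
  cast : ∀ a c b d → a + 6 ℕ.* b ≡ 5 ℕ.* c + 3 ℕ.* d →
         + a ℤ.+ + 6 ℤ.* + b ≡ + 5 ℤ.* + c ℤ.+ + 3 ℤ.* + d
  cast a c b d eq = begin
    + a ℤ.+ + 6 ℤ.* + b         ≡⟨ cong (ℤ._+_ (+ a)) (ℤ.pos-* 6 b) ⟨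
    -- Sums of nonnegative integers agree with `+_` by computation; only products need `pos-*`.
    + (a + 6 ℕ.* b)             ≡⟨ cong +_ eq ⟩
    + (5 ℕ.* c) ℤ.+ + (3 ℕ.* d) ≡⟨ cong₂ ℤ._+_ (ℤ.pos-* 5 c) (ℤ.pos-* 3 d) ⟩
    + 5 ℤ.* + c ℤ.+ + 3 ℤ.* + d ∎
  solve : ∀ a c b d → a + 6 ℕ.* b ≡ 5 ℕ.* c + 3 ℕ.* d →
          + a ≡ + 5 ℤ.* + c ℤ.- + 6 ℤ.* + b ℤ.+ + 3 ℤ.* + d
  solve a c b d eq = begin
    + a                                             ≡⟨ add-subtract (+ a) (+ b) ⟩
    (+ a ℤ.+ + 6 ℤ.* + b) ℤ.- + 6 ℤ.* + b           ≡⟨ cong (λ s → s ℤ.- + 6 ℤ.* + b)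
                                                            (cast a c b d eq) ⟩
    (+ 5 ℤ.* + c ℤ.+ + 3 ℤ.* + d) ℤ.- + 6 ℤ.* + b   ≡⟨ rearrange (+ b) (+ c) (+ d) ⟩
    + 5 ℤ.* + c ℤ.- + 6 ℤ.* + b ℤ.+ + 3 ℤ.* + d     ∎

theorem22 : let T = (2 ∷ 1 ∷ 4 ∷ 3 ∷ []) ∷ (2 ∷ 3 ∷ 4 ∷ 1 ∷ []) ∷ (2 ∷ 4 ∷ 1 ∷ 3 ∷ []) ∷ [] in
    F T ≈ polynomial (+ 1 ∷ - (+ 4) ∷ + 3 ∷ - (+ 1) ∷ [])
    / polynomial (+ 1 ∷ - (+ 5) ∷ + 6 ∷ - (+ 3) ∷ [])
theorem22 n = trans (F≈count n)
  (quotient-recurrence (polynomial (+ 1 ∷ - (+ 4) ∷ + 3 ∷ - (+ 1) ∷ [])) count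
    -- Degrees 0 to 3 are checked by evaluation. The recurrence on counts begins only at degree 4:
    -- at degree 3 it would give 7 instead of 6, whence the last coefficient of the numerator.
    refl refl refl refl (λ _ → refl) count-recurrence n)
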